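{- Let $S_1=\{n\in\mathbb{Z} : n\ge 230\}$ and $$S_2=\{91,94,95\}\cup\{119,\dots,124\}\cup\{131,136\}\cup\{152,\dots,170\}\cup\{172,178,181,184,185\}\cup\{189,\dots,223\}.$$ For every $n\in S_1\cup S_2$, the Fibonacci-run graph $\mathcal{R}_n$ satisfies $$\operatorname{diam}(\mathcal{R}_n)>n-\left\lfloor\sqrt{1+\tfrac{n}{2}}-\tfrac34\right\rfloor .$$
   Context: A binary string is run-constrained if every maximal run of 1s in it is immediately followed by a maximal run of 0s of strictly greater length. For $n\ge 0$, the Fibonacci-run graph $\mathcal{R}_n$ has as vertices all binary strings $r$ of length $n$ such that $r00$ (the string $r$ followed by two 0s) is run-constrained; two vertices are adjacent if they differ in exactly one coordinate. $\operatorname{diam}(G)$ denotes the maximum graph distance between two vertices of the connected graph $G$. -}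

module Defs where

open import Data.Bool using (Bool; true; false; _≟_)
open import Data.Nat using (ℕ; zero; suc; _+_; _*_; _∸_; _≤_; _<_)
open import Data.List using (List; []; _∷_; _++_; map; upTo)
open import Data.List.Membership.Propositional using (_∈_)
open import Data.Vec using (Vec; toList)
import Data.Vec as V
open import Data.Product using (Σ; ∃; ∃-syntax; _×_; _,_; proj₁)
open import Data.Sum using (_⊎_)
open import Data.Unit using (⊤)
open import Data.Empty using (⊥)
open import Relation.Nullary using (does)
open import Relation.Binary.PropositionalEquality using (_≡_)

runs : List Bool → List (Bool × ℕ)
runs [] = []
runs (x ∷ xs) with runs xs
... | [] = (x , 1) ∷ []
... | (y , m) ∷ rs with does (x ≟ y)
...   | true  = (y , suc m) ∷ rs
...   | false = (x , 1) ∷ (y , m) ∷ rs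

-- Condition on the run list: every run of 1s is immediately followed by a
-- run (necessarily of 0s, by maximality) of strictly greater length.
RunsOK : List (Bool × ℕ) → Set
RunsOK [] = ⊤
RunsOK ((false , _) ∷ rs) = RunsOK rs
RunsOK ((true , a) ∷ []) = ⊥
RunsOK ((true , a) ∷ (b , c) ∷ rs) = (a < c) × RunsOK ((b , c) ∷ rs)

RunConstrained : List Bool → Set
RunConstrained w = RunsOK (runs w)

Vertex : ℕ → Set
Vertex n = Σ (Vec Bool n) (λ r → RunConstrained (toList r ++ false ∷ false ∷ []))

hamming : ∀ {n} → Vec Bool n → Vec Bool n → ℕ
hamming V.[] V.[] = 0
hamming (x V.∷ xs) (y V.∷ ys) with does (x ≟ y)
... | true  = hamming xs ys
... | false = suc (hamming xs ys)

Adj : ∀ {n} → Vertex n → Vertex n → Set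
Adj u v = hamming (proj₁ u) (proj₁ v) ≡ 1

data Walk {n : ℕ} : Vertex n → Vertex n → ℕ → Set where
  stay : ∀ {u} → Walk u u 0
  step : ∀ {u w v k} → Adj u w → Walk w v k → Walk u v (suc k)

Dist : ∀ {n} → Vertex n → Vertex n → ℕ → Set
Dist u v d = Walk u v d × (∀ e → Walk u v e → d ≤ e)

-- D is the diameter of R_n (forces connectedness: every pair has a distance).
IsDiam : ℕ → ℕ → Set
IsDiam n D = (∀ (u v : Vertex n) → ∃[ d ] (Dist u v d × d ≤ D))
           × (∃[ u ] ∃[ v ] Dist {n} u v D)

-- k = ⌊ √(1 + n/2) − 3/4 ⌋ , characterised exactly (for n ≥ 0, k ≥ 0):
-- k + 3/4 ≤ √(1+n/2) < k + 7/4  ⇔  (4k+3)² ≤ 16 + 8n < (4k+7)².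
IsFloorTerm : ℕ → ℕ → Set
IsFloorTerm n k = ((4 * k + 3) * (4 * k + 3) ≤ 16 + 8 * n)
                × (16 + 8 * n < (4 * k + 7) * (4 * k + 7))

interval : ℕ → ℕ → List ℕ
interval a b = map (a +_) (upTo (suc (b ∸ a)))

S₂ : List ℕ
S₂ = (91 ∷ 94 ∷ 95 ∷ [])
  ++ interval 119 124
  ++ (131 ∷ 136 ∷ [])
  ++ interval 152 170
  ++ (172 ∷ 178 ∷ 181 ∷ 184 ∷ 185 ∷ [])
  ++ interval 189 223

InS : ℕ → Set
InS n = (230 ≤ n) ⊎ (n ∈ S₂)

{-# OPTIONS --safe #-}
module Submission where

-- Switching off a 1 strictly inside a run of 1s creates 101, which is forbidden.
-- So if the first word has a run of 1s in which the second word has m separated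
-- 1s, at most one of these m common 1s survives a walk between the two words;
-- each of the others is flipped twice, and the distance is at least
-- n + (m - 2) - (number of common 0s). Otherwise the words are complementary,
-- with runs of 1s alternating between them. The lengths of these runs increase,
-- and the j common 0s at the end allow runs of length up to 2j + 2. A larger gain
-- m - 2 shortens the sequence of runs by a bounded amount, while every further
-- common 0 lengthens the words by about 4j, so for large n the gain wins.

open import Defs
open import Data.Bool as Bool using (Bool; true; false; not; _∧_; b≤b)
open import Data.Bool.Properties using (not-involutive; ≤-maximum)
open import Data.Empty using (⊥-elim)
open import Data.Fin as Fin using (Fin)
open import Data.Fin.Properties using (any?)
open import Data.List using (List; []; _∷_; _++_; replicate; length; map)
open import Data.List.Membership.Propositional using (_∈_)
open import Data.List.Membership.Propositional.Properties using (∈-map⁺; ∈-upTo⁺)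
open import Data.List.Properties using (++-assoc; map-++; map-replicate; length-++; length-replicate)
open import Data.List.Relation.Binary.Pointwise as Pointwise using (Pointwise; _∷_)
open import Data.List.Relation.Unary.All as All using (All)
open import Data.List.Relation.Unary.Any using (here; there)
open import Data.Nat
open import Data.Nat.Properties
open import Data.Nat.Tactic.RingSolver using (solve-∀)
open import Data.Product using (∃; ∃-syntax; Σ-syntax; _×_; _,_; proj₁; proj₂)
open import Data.Sum using (_⊎_; inj₁; inj₂; [_,_]′)
open import Data.Unit using (tt)
open import Data.Vec as Vec using (Vec; []; _∷_; toList)
import Data.Vec.Properties as Vec
open import Relation.Binary.PropositionalEquality
open import Relation.Nullary using (¬_; Dec; yes; no; does)
open import Relation.Nullary.Decidable using (from-yes; map′; _×-dec_; _⊎-dec_)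
open import Relation.Unary using (Decidable)

-- Run-constrained words

-- The recursive step of `runs` as a function on run lists, so that words can be handled by
-- rewriting with `runs-∷`.
push : Bool → List (Bool × ℕ) → List (Bool × ℕ)
push x [] = (x , 1) ∷ []
push false ((false , m) ∷ rs) = (false , suc m) ∷ rs
push false ((true , m) ∷ rs) = (false , 1) ∷ (true , m) ∷ rs
push true ((false , m) ∷ rs) = (true , 1) ∷ (false , m) ∷ rs
push true ((true , m) ∷ rs) = (true , suc m) ∷ rs

runs-∷ : ∀ x w → runs (x ∷ w) ≡ push x (runs w)
runs-∷ x w with runs w
runs-∷ x w | [] = refl
runs-∷ false w | (false , m) ∷ rs = refl
runs-∷ false w | (true , m) ∷ rs = refl
runs-∷ true w | (false , m) ∷ rs = refl
runs-∷ true w | (true , m) ∷ rs = refl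

RunsOK-push-false : ∀ rs → RunsOK rs → RunsOK (push false rs)
RunsOK-push-false [] ok = ok
RunsOK-push-false ((false , m) ∷ rs) ok = ok
RunsOK-push-false ((true , m) ∷ rs) ok = ok

-- Losing the first letter shortens or removes the first run; a shortened run of 1s needs no more
-- zeros than before.
RunsOK-pop : ∀ x rs → RunsOK (push x rs) → RunsOK rs
RunsOK-pop x [] ok = tt
RunsOK-pop false ((false , m) ∷ rs) ok = ok
RunsOK-pop false ((true , m) ∷ rs) ok = ok
RunsOK-pop true ((false , m) ∷ rs) (_ , ok) = ok
RunsOK-pop true ((true , m) ∷ (_ , c) ∷ rs) (m<c , ok) = <-trans (n<1+n m) m<c , ok

-- The first 1 and the 0 after it are runs of length 1, where 1 < 1 would be required.
¬RunsOK-push-101 : ∀ rs → ¬ RunsOK (push true (push false (push true rs)))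
¬RunsOK-push-101 [] (1<1 , _) = <-irrefl refl 1<1
¬RunsOK-push-101 ((false , m) ∷ rs) (1<1 , _) = <-irrefl refl 1<1
¬RunsOK-push-101 ((true , m) ∷ rs) (1<1 , _) = <-irrefl refl 1<1

RC-false∷ : ∀ w → RunConstrained w → RunConstrained (false ∷ w)
RC-false∷ w ok = subst RunsOK (sym (runs-∷ false w)) (RunsOK-push-false (runs w) ok)

RC-tail : ∀ {x} w → RunConstrained (x ∷ w) → RunConstrained w
RC-tail {x} w ok = RunsOK-pop x (runs w) (subst RunsOK (runs-∷ x w) ok)

¬RC-101 : ∀ w → ¬ RunConstrained (true ∷ false ∷ true ∷ w)
¬RC-101 w ok = ¬RunsOK-push-101 (runs w) (subst RunsOK eq ok)
  where
  eq : runs (true ∷ false ∷ true ∷ w) ≡ push true (push false (push true (runs w)))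
  eq = trans (runs-∷ true (false ∷ true ∷ w)) (cong (push true)
         (trans (runs-∷ false (true ∷ w)) (cong (push false) (runs-∷ true w))))

RC-zeros : ∀ c w → RunConstrained w → RunConstrained (replicate c false ++ w)
RC-zeros zero w ok = ok
RC-zeros (suc c) w ok = RC-false∷ (replicate c false ++ w) (RC-zeros c w ok)

-- Only a lower bound on the first run, since `w` may itself begin with zeros.
runs-zeros : ∀ c w → ∃[ c′ ] ∃[ rs ] (c < c′ × runs (replicate (suc c) false ++ w) ≡ (false , c′) ∷ rs)
runs-zeros zero w rewrite runs-∷ false w with runs w
... | [] = 1 , [] , s≤s z≤n , refl
... | (false , m) ∷ rs = suc m , rs , s≤s z≤n , refl
... | (true , m) ∷ rs = 1 , (true , m) ∷ rs , s≤s z≤n , refl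
runs-zeros (suc c) w with runs-zeros c w
... | c′ , rs , c<c′ , eq =
  suc c′ , rs , s≤s c<c′ , trans (runs-∷ false (replicate (suc c) false ++ w)) (cong (push false) eq)

runs-ones : ∀ a {w c rs} → runs w ≡ (false , c) ∷ rs →
  runs (replicate (suc a) true ++ w) ≡ (true , suc a) ∷ (false , c) ∷ rs
runs-ones zero {w} eq = trans (runs-∷ true w) (cong (push true) eq)
runs-ones (suc a) {w} eq =
  trans (runs-∷ true (replicate (suc a) true ++ w)) (cong (push true) (runs-ones a eq))

RC-block : ∀ {a c} w → a < c → RunConstrained w →
  RunConstrained (replicate a true ++ replicate c false ++ w)
RC-block {zero} {c} w a<c ok = RC-zeros c w ok
RC-block {suc a} {suc c} w (s≤s a<c) ok with runs-zeros c w
... | c′ , rs , c<c′ , eq = subst RunsOK (sym (runs-ones a eq))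
  (<-≤-trans (s≤s a<c) c<c′ , subst RunsOK eq (RC-zeros (suc c) w ok))

-- Vertices carry a proof; its uniqueness turns equality of words into the equality of vertices that
-- the indices of `Walk` demand.
RunsOK-irrelevant : ∀ rs (p q : RunsOK rs) → p ≡ q
RunsOK-irrelevant [] p q = refl
RunsOK-irrelevant ((false , _) ∷ rs) p q = RunsOK-irrelevant rs p q
RunsOK-irrelevant ((true , a) ∷ (b , c) ∷ rs) (p , ps) (q , qs) =
  cong₂ _,_ (<-irrelevant p q) (RunsOK-irrelevant ((b , c) ∷ rs) ps qs)

RunsOK? : Decidable RunsOK
RunsOK? [] = yes tt
RunsOK? ((false , _) ∷ rs) = RunsOK? rs
RunsOK? ((true , a) ∷ []) = no λ ()
RunsOK? ((true , a) ∷ (b , c) ∷ rs) = (a <? c) ×-dec RunsOK? ((b , c) ∷ rs)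

RC? : Decidable RunConstrained
RC? w = RunsOK? (runs w)

-- Distances

hamming-refl : ∀ {n} (w : Vec Bool n) → hamming w w ≡ 0
hamming-refl [] = refl
hamming-refl (false ∷ w) = hamming-refl w
hamming-refl (true ∷ w) = hamming-refl w

hamming-sym : ∀ {n} (w w′ : Vec Bool n) → hamming w w′ ≡ hamming w′ w
hamming-sym [] [] = refl
hamming-sym (false ∷ w) (false ∷ w′) = hamming-sym w w′
hamming-sym (false ∷ w) (true ∷ w′) = cong suc (hamming-sym w w′)
hamming-sym (true ∷ w) (false ∷ w′) = cong suc (hamming-sym w w′)
hamming-sym (true ∷ w) (true ∷ w′) = hamming-sym w w′

hamming≡0 : ∀ {n} (w w′ : Vec Bool n) → hamming w w′ ≡ 0 → w ≡ w′
hamming≡0 [] [] eq = refl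
hamming≡0 (false ∷ w) (false ∷ w′) eq = cong (false ∷_) (hamming≡0 w w′ eq)
hamming≡0 (true ∷ w) (true ∷ w′) eq = cong (true ∷_) (hamming≡0 w w′ eq)

vertex-≡ : ∀ {n} {u v : Vertex n} → proj₁ u ≡ proj₁ v → u ≡ v
vertex-≡ {u = w , p} {_ , q} refl =
  cong (w ,_) (RunsOK-irrelevant (runs (toList w ++ false ∷ false ∷ [])) p q)

_++ʷ_ : ∀ {n d e} {u v w : Vertex n} → Walk u v d → Walk v w e → Walk u w (d + e)
stay ++ʷ q = q
step a p ++ʷ q = step a (p ++ʷ q)

reverseʷ : ∀ {n d} {u v : Vertex n} → Walk u v d → Walk v u d
reverseʷ stay = stay
reverseʷ {d = suc d} {u} (step {w = w} a p) =
  subst (Walk _ u) (+-comm d 1)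
    (reverseʷ p ++ʷ step (trans (hamming-sym (proj₁ w) (proj₁ u)) a) stay)

false∷ᵛ : ∀ {n} → Vertex n → Vertex (suc n)
false∷ᵛ (w , ok) = false ∷ w , RC-false∷ (toList w ++ false ∷ false ∷ []) ok

false∷ʷ : ∀ {n d} {u v : Vertex n} → Walk u v d → Walk (false∷ᵛ u) (false∷ᵛ v) d
false∷ʷ stay = stay
false∷ʷ (step a p) = step a (false∷ʷ p)

zeroᵛ : ∀ n → Vertex n
zeroᵛ zero = [] , tt
zeroᵛ (suc n) = false∷ᵛ (zeroᵛ n)

-- Switching off the leftmost 1 keeps a word run-constrained.
walk-to-zero : ∀ {n} (u : Vertex n) → ∃[ d ] (d ≤ n × Walk u (zeroᵛ n) d)
walk-to-zero ([] , ok) = 0 , z≤n , subst (λ v → Walk v (zeroᵛ 0) 0) (vertex-≡ refl) stay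
walk-to-zero {suc n} (false ∷ w , ok) with walk-to-zero (w , RC-tail (toList w ++ _) ok)
... | d , d≤n , p = d , m≤n⇒m≤1+n d≤n ,
  subst (λ v → Walk v (zeroᵛ (suc n)) d) (vertex-≡ refl) (false∷ʷ p)
walk-to-zero (true ∷ w , ok) with walk-to-zero (w , RC-tail (toList w ++ _) ok)
... | d , d≤n , p = suc d , s≤s d≤n , step (cong suc (hamming-refl w)) (false∷ʷ p)

connected : ∀ {n} (u v : Vertex n) → ∃[ d ] (d ≤ n + n × Walk u v d)
connected u v with walk-to-zero u | walk-to-zero v
... | d , d≤n , p | e , e≤n , q = d + e , +-mono-≤ d≤n e≤n , p ++ʷ reverseʷ q

-- Decidability of walks and existence of the diameter

anyVec? : ∀ {n} {P : Vec Bool n → Set} → Decidable P → Dec (∃ P)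
anyVec? {zero} P? = map′ ([] ,_) (λ { ([] , p) → p }) (P? [])
anyVec? {suc n} P? =
  map′ (λ { (inj₁ (w , p)) → false ∷ w , p ; (inj₂ (w , p)) → true ∷ w , p })
       (λ { (false ∷ w , p) → inj₁ (w , p) ; (true ∷ w , p) → inj₂ (w , p) })
       (anyVec? (λ w → P? (false ∷ w)) ⊎-dec anyVec? (λ w → P? (true ∷ w)))

anyVertex? : ∀ {n} {P : Vertex n → Set} → Decidable P → Dec (∃ P)
anyVertex? {P = P} P? =
  map′ (λ { (w , ok , p) → (w , ok) , p }) (λ { ((w , ok) , p) → w , ok , p }) (anyVec? at?)
  where
  at? : Decidable (λ w → Σ[ ok ∈ _ ] P (w , ok))
  at? w with RC? (toList w ++ false ∷ false ∷ [])
  ... | no ¬ok = no λ (ok , _) → ¬ok ok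
  ... | yes ok = map′ (ok ,_) (λ (_ , p) → subst P (vertex-≡ refl) p) (P? (w , ok))

walk? : ∀ {n} (u v : Vertex n) → Decidable (Walk u v)
walk? u v zero = map′ (λ eq → subst (λ v → Walk u v 0) (vertex-≡ eq) stay)
                      (λ { stay → refl })
                      (Vec.≡-dec Bool._≟_ (proj₁ u) (proj₁ v))
walk? u v (suc d) =
  map′ (λ { (w , a , p) → step a p }) (λ { (step a p) → _ , a , p })
       (anyVertex? λ w → (hamming (proj₁ u) (proj₁ w) ≟ 1) ×-dec walk? w v d)

least : ∀ {P : ℕ → Set} → Decidable P → ∀ m → P m →
  ∃[ d ] (P d × d ≤ m × ∀ e → P e → d ≤ e)
least P? zero p = 0 , p , z≤n , λ _ _ → z≤n
least P? (suc m) p with P? 0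
... | yes p₀ = 0 , p₀ , z≤n , λ _ _ → z≤n
... | no ¬p₀ with least (λ d → P? (suc d)) m p
...   | d , pd , d≤m , min =
  suc d , pd , s≤s d≤m , λ { zero p₀ → ⊥-elim (¬p₀ p₀) ; (suc e) pe → s≤s (min e pe) }

greatest : ∀ {P : ℕ → Set} → Decidable P → ∀ b → (∀ d → P d → d ≤ b) → ∃ P →
  ∃[ d ] (P d × ∀ e → P e → e ≤ d)
greatest P? zero bound (m , p) = m , p , λ e pe → ≤-trans (bound e pe) z≤n
greatest P? (suc b) bound (m , p) with P? (suc b)
... | yes pb = suc b , pb , bound
... | no ¬pb = greatest P? b
  (λ d pd → s≤s⁻¹ (≤∧≢⇒< (bound d pd) λ { refl → ¬pb pd })) (m , p)

distance : ∀ {n} (u v : Vertex n) → ∃[ d ] (Dist u v d × d ≤ n + n)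
distance u v with connected u v
... | m , m≤ , p with least (walk? u v) m p
...   | d , q , d≤m , min = d , (q , min) , ≤-trans d≤m m≤

-- Distances are at most 2n and attainment of a value is decidable, so a greatest distance exists;
-- it is at least the distance from `u` to `v`.
diameter : ∀ {n L} (u v : Vertex n) → (∀ e → Walk u v e → L ≤ e) → ∃[ D ] (IsDiam n D × L ≤ D)
diameter {n} u v far
  with greatest {P = λ D → ∃[ u ] ∃[ v ] proj₁ (distance {n} u v) ≡ D}
         (λ D → anyVertex? λ u → anyVertex? λ v → proj₁ (distance u v) ≟ D)
         (n + n) (λ { _ (u , v , refl) → proj₂ (proj₂ (distance u v)) })
         -- The search needs one attained value to start from.
         (_ , zeroᵛ n , zeroᵛ n , refl)
... | D , (u₀ , v₀ , eq) , max =
  D , ((λ u v → let d , dist , _ = distance u v in d , dist , max d (u , v , refl))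
      , u₀ , v₀ , subst (Dist u₀ v₀) eq (proj₁ (proj₂ (distance u₀ v₀))))
    , (let d , (p , _) , _ = distance u v in ≤-trans (far d p) (max d (u , v , refl)))

-- The lower bound on distances

-- A pair of words is stored as one list of columns, which makes common 1s and common 0s single
-- letters.
Column : Set
Column = Bool × Bool

entry : Bool → Column → Bool
entry true = proj₁
entry false = proj₂

row : Bool → List Column → List Bool
row s = map (entry s)

rowᵛ : Bool → (c : List Column) → Vec Bool (length c)
rowᵛ s [] = []
rowᵛ s (x ∷ c) = entry s x ∷ rowᵛ s c

toList-rowᵛ : ∀ s c → toList (rowᵛ s c) ≡ row s c
toList-rowᵛ s [] = refl
toList-rowᵛ s (x ∷ c) = cong (entry s x ∷_) (toList-rowᵛ s c)

-- The Hamming distance from w to the second row of c, plus 2 for every column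
-- (1 , 1) of c, other than the first, below the same run of 1s of w. The flag
-- tells whether the current run of w has met such a column.
potential : Bool → (c : List Column) → Vec Bool (length c) → ℕ
potential b [] [] = 0
potential b ((_ , false) ∷ c) (false ∷ w) = potential false c w
potential b ((_ , true) ∷ c) (false ∷ w) = suc (potential false c w)
potential b ((_ , false) ∷ c) (true ∷ w) = suc (potential b c w)
potential b ((false , true) ∷ c) (true ∷ w) = potential b c w
potential false ((true , true) ∷ c) (true ∷ w) = potential true c w
potential true ((true , true) ∷ c) (true ∷ w) = suc (suc (potential true c w))

potential-false≤ : ∀ b c w → potential false c w ≤ potential b c w
potential-false≤ false c w = ≤-refl
potential-false≤ true [] [] = z≤n
potential-false≤ true ((_ , false) ∷ c) (false ∷ w) = ≤-refl
potential-false≤ true ((_ , true) ∷ c) (false ∷ w) = ≤-refl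
potential-false≤ true ((_ , false) ∷ c) (true ∷ w) = s≤s (potential-false≤ true c w)
potential-false≤ true ((false , true) ∷ c) (true ∷ w) = potential-false≤ true c w
potential-false≤ true ((true , true) ∷ c) (true ∷ w) = m≤n+m _ 2

-- The flag matters only at the next common 1 of the current run: there it is worth 2, and
-- afterwards it is set in either case.
potential-true≤ : ∀ c w → potential true c w ≤ 2 + potential false c w
potential-true≤ [] [] = z≤n
potential-true≤ ((_ , false) ∷ c) (false ∷ w) = m≤n+m _ 2
potential-true≤ ((_ , true) ∷ c) (false ∷ w) = m≤n+m _ 2
potential-true≤ ((_ , false) ∷ c) (true ∷ w) = s≤s (potential-true≤ c w)
potential-true≤ ((false , true) ∷ c) (true ∷ w) = potential-true≤ c w
potential-true≤ ((true , true) ∷ c) (true ∷ w) = ≤-refl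

-- After 10 the word cannot go on with 1, so it ends or the next 0 clears the flag.
potential-reset : ∀ b c w → RunConstrained (true ∷ false ∷ toList w ++ false ∷ false ∷ []) →
  potential b c w ≡ potential false c w
potential-reset b [] [] ok = refl
potential-reset b ((_ , false) ∷ c) (false ∷ w) ok = refl
potential-reset b ((_ , true) ∷ c) (false ∷ w) ok = refl
potential-reset b (_ ∷ c) (true ∷ w) ok = ⊥-elim (¬RC-101 (toList w ++ false ∷ false ∷ []) ok)

potential-on : ∀ b x c w → potential b (x ∷ c) (false ∷ w) ≤ suc (potential b (x ∷ c) (true ∷ w))
potential-on b (_ , false) c w = m≤n⇒m≤1+n (m≤n⇒m≤1+n (potential-false≤ b c w))
potential-on b (false , true) c w = s≤s (potential-false≤ b c w)
potential-on false (true , true) c w = s≤s (potential-false≤ true c w)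
potential-on true (true , true) c w = s≤s (m≤n⇒m≤1+n (m≤n⇒m≤1+n (potential-false≤ true c w)))

-- A 1 is switched off only at an end of its run: inside, 101 would appear.
potential-off : ∀ {p} b x c w → b Bool.≤ p →
  RunConstrained (p ∷ false ∷ toList w ++ false ∷ false ∷ []) →
  potential b (x ∷ c) (true ∷ w) ≤ suc (potential b (x ∷ c) (false ∷ w))
potential-off {false} false (_ , false) c w _ ok = ≤-refl
potential-off {false} false (false , true) c w _ ok = m≤n+m _ 2
potential-off {false} false (true , true) c w _ ok = potential-true≤ c w
potential-off {true} b (_ , false) c w _ ok = s≤s (≤-reflexive (potential-reset b c w ok))
potential-off {true} b (false , true) c w _ ok
  rewrite potential-reset b c w ok = m≤n+m _ 2
potential-off {true} false (true , true) c w _ ok = potential-true≤ c w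
-- The 2 lost here is made up by the new mismatch and by the step itself.
potential-off {true} true (true , true) c w _ ok =
  s≤s (s≤s (≤-reflexive (potential-reset true c w ok)))

-- For the induction on suffixes, `p` is the letter just before them: a 101 around the flipped
-- coordinate stays visible. The flag can be set only after a 1, whence `b ≤ p`.
potential-step : ∀ {p} b c w w′ → b Bool.≤ p →
  RunConstrained (p ∷ toList w′ ++ false ∷ false ∷ []) → hamming w w′ ≡ 1 →
  potential b c w ≤ suc (potential b c w′)
potential-step b [] [] [] b≤p ok ()
potential-step b (x ∷ c) (false ∷ w) (true ∷ w′) b≤p ok eq
  rewrite hamming≡0 w w′ (suc-injective eq) = potential-on b x c w′
potential-step b (x ∷ c) (true ∷ w) (false ∷ w′) b≤p ok eq
  rewrite hamming≡0 w w′ (suc-injective eq) = potential-off b x c w′ b≤p ok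
potential-step b ((_ , false) ∷ c) (false ∷ w) (false ∷ w′) b≤p ok eq =
  potential-step false c w w′ b≤b (RC-tail (false ∷ toList w′ ++ _) ok) eq
potential-step b ((_ , true) ∷ c) (false ∷ w) (false ∷ w′) b≤p ok eq =
  s≤s (potential-step false c w w′ b≤b (RC-tail (false ∷ toList w′ ++ _) ok) eq)
potential-step b ((_ , false) ∷ c) (true ∷ w) (true ∷ w′) b≤p ok eq =
  s≤s (potential-step b c w w′ (≤-maximum b) (RC-tail (true ∷ toList w′ ++ _) ok) eq)
potential-step b ((false , true) ∷ c) (true ∷ w) (true ∷ w′) b≤p ok eq =
  potential-step b c w w′ (≤-maximum b) (RC-tail (true ∷ toList w′ ++ _) ok) eq
potential-step false ((true , true) ∷ c) (true ∷ w) (true ∷ w′) b≤p ok eq =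
  potential-step true c w w′ b≤b (RC-tail (true ∷ toList w′ ++ _) ok) eq
potential-step true ((true , true) ∷ c) (true ∷ w) (true ∷ w′) b≤p ok eq =
  s≤s (s≤s (potential-step true c w w′ b≤b (RC-tail (true ∷ toList w′ ++ _) ok) eq))

potential-walk : ∀ c {u v : Vertex (length c)} {e} → Walk u v e →
  potential false c (proj₁ u) ≤ e + potential false c (proj₁ v)
potential-walk c stay = ≤-refl
potential-walk c {u} (step {w = w , ok} a p) =
  -- An imaginary 0 before the word serves as the preceding letter.
  ≤-trans (potential-step false c (proj₁ u) w b≤b (RC-false∷ (toList w ++ _) ok) a)
          (s≤s (potential-walk c p))

-- The flag at the end of `c` depends on `c`, so the value on `d` is assumed equal for both flags;
-- blocks without common 1s satisfy this.
potential-++ : ∀ b s c d {k} → (∀ b → potential b d (rowᵛ s d) ≡ k) →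
  potential b (c ++ d) (rowᵛ s (c ++ d)) ≡ potential b c (rowᵛ s c) + k
potential-++ b s [] d eq = eq b
potential-++ b true ((false , false) ∷ c) d eq = potential-++ false true c d eq
potential-++ b true ((false , true) ∷ c) d eq = cong suc (potential-++ false true c d eq)
potential-++ b true ((true , false) ∷ c) d eq = cong suc (potential-++ b true c d eq)
potential-++ false true ((true , true) ∷ c) d eq = potential-++ true true c d eq
potential-++ true true ((true , true) ∷ c) d eq = cong (2 +_) (potential-++ true true c d eq)
potential-++ b false ((false , false) ∷ c) d eq = potential-++ false false c d eq
potential-++ b false ((true , false) ∷ c) d eq = potential-++ false false c d eq
potential-++ b false ((false , true) ∷ c) d eq = potential-++ b false c d eq
potential-++ false false ((true , true) ∷ c) d eq = potential-++ true false c d eq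
potential-++ true false ((true , true) ∷ c) d eq = cong (2 +_) (potential-++ true false c d eq)

-- By `potential-walk`, a lower bound for the distance between the two rows when `residue` is 0.
cost : List Column → ℕ
cost c = potential false c (rowᵛ true c)

-- Zero exactly when no run of 1s of the second row contains two common 1s.
residue : List Column → ℕ
residue c = potential false c (rowᵛ false c)

only : Bool → Column
only true = true , false
only false = false , true

gap : Column
gap = false , false

cost-only : ∀ c s z → cost (c ++ replicate z (only s)) ≡ cost c + z
cost-only c s z = potential-++ false true c (replicate z (only s)) (λ b → lemma b s z)
  where
  lemma : ∀ b s z → potential b (replicate z (only s)) (rowᵛ true (replicate z (only s))) ≡ z
  lemma b s zero = refl
  lemma b true (suc z) = cong suc (lemma b true z)
  lemma b false (suc z) = cong suc (lemma false false z)

residue-only : ∀ c s z → residue (c ++ replicate z (only s)) ≡ residue c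
residue-only c s z =
  trans (potential-++ false false c (replicate z (only s)) (λ b → lemma b s z)) (+-identityʳ _)
  where
  lemma : ∀ b s z → potential b (replicate z (only s)) (rowᵛ false (replicate z (only s))) ≡ 0
  lemma b s zero = refl
  lemma b true (suc z) = lemma false true z
  lemma b false (suc z) = lemma b false z

potential-gap : ∀ s c z →
  potential false (c ++ replicate z gap) (rowᵛ s (c ++ replicate z gap)) ≡ potential false c (rowᵛ s c)
potential-gap s c z =
  trans (potential-++ false s c (replicate z gap) (λ b → lemma b s z)) (+-identityʳ _)
  where
  lemma : ∀ b s z → potential b (replicate z gap) (rowᵛ s (replicate z gap)) ≡ 0
  lemma b s zero = refl
  lemma b true (suc z) = lemma false true z
  lemma b false (suc z) = lemma false false z

record Certificate (n : ℕ) : Set where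
  field
    columns : List Column
    length-columns : length columns ≡ n
    valid : ∀ s → RunConstrained (row s columns ++ false ∷ false ∷ [])
    residue≡0 : residue columns ≡ 0
    k : ℕ
    k-bound : (4 * k + 3) * (4 * k + 3) ≤ 16 + 8 * n
    n∸k<cost : n ∸ k < cost columns

-- `k-bound` keeps the certified `k` at or below the floor term, so subtracting the floor term from
-- n leaves at most `n ∸ k`.
theorem-from-certificate : ∀ {n} → Certificate n →
  ∃[ D ] (IsDiam n D × (∀ k → IsFloorTerm n k → n ∸ k < D))
theorem-from-certificate record { columns = c ; length-columns = refl ; valid = valid
  ; residue≡0 = res ; k = k₀ ; k-bound = low ; n∸k<cost = n∸k₀<cost } = D , isDiam , far
  where
  vertex : Bool → Vertex (length c)
  vertex s = rowᵛ s c ,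
    subst (λ w → RunConstrained (w ++ false ∷ false ∷ [])) (sym (toList-rowᵛ s c)) (valid s)
  cost≤ : ∀ e → Walk (vertex true) (vertex false) e → cost c ≤ e
  cost≤ e p = ≤-trans (potential-walk c p) (≤-reflexive (trans (cong (e +_) res) (+-identityʳ e)))
  diam = diameter (vertex true) (vertex false) cost≤
  D = proj₁ diam
  isDiam = proj₁ (proj₂ diam)
  far : ∀ k → IsFloorTerm (length c) k → length c ∸ k < D
  far k (_ , high) = <-≤-trans n∸k<cost (proj₂ (proj₂ diam))
    where
    -- Otherwise 4k + 7 ≤ 4k₀ + 3, and squaring contradicts the two bounds on 16 + 8n.
    k₀≤k : k₀ ≤ k
    k₀≤k with k₀ ≤? k
    ... | yes p = p
    ... | no k₀≰k = ⊥-elim (<-irrefl refl (<-≤-trans high (≤-trans (*-mono-≤ q q) low)))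
      where
      q : 4 * k + 7 ≤ 4 * k₀ + 3
      q = ≤-trans (≤-reflexive (trans (+-comm (4 * k) 7) (cong (3 +_) (sym (*-suc 4 k)))))
            (≤-trans (+-monoʳ-≤ 3 (*-monoʳ-≤ 4 (≰⇒> k₀≰k))) (≤-reflexive (+-comm 3 (4 * k₀))))
    n∸k<cost : length c ∸ k < cost c
    n∸k<cost = ≤-<-trans (∸-monoʳ-≤ (length c) k₀≤k) n∸k₀<cost

-- Pairs of words of large length

-- `Free` and `Need` describe a prefix by the continuations it admits, which avoids inspecting its
-- runs.
Free : List Bool → Set
Free q = ∀ t → RunConstrained t → RunConstrained (q ++ t)

Need : ℕ → List Bool → Set
Need y p = ∀ z t → y < z → RunConstrained t → RunConstrained (p ++ replicate z false ++ t)

Free⇒Need : ∀ q y → Free q → Need y (q ++ replicate y true)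
Free⇒Need q y free z t y<z ok =
  subst RunConstrained (sym (++-assoc q (replicate y true) (replicate z false ++ t)))
    (free (replicate y true ++ replicate z false ++ t) (RC-block t y<z ok))

Need⇒Free : ∀ p {y z} → y < z → Need y p → Free (p ++ replicate z false)
Need⇒Free p {z = z} y<z need t ok =
  subst RunConstrained (sym (++-assoc p (replicate z false) t)) (need z t y<z ok)

-- The beginning, of length l, of a pair of words: the row `side` still has to be
-- continued by more than y 0s, and the cost exceeds the length by the gain g.
record Head (g l y : ℕ) : Set where
  field
    columns : List Column
    length-columns : length columns ≡ l
    side : Bool
    need : Need y (row side columns)
    free : Free (row (not side) columns)
    cost≡ : cost columns ≡ g + l
    residue≡0 : residue columns ≡ 0

weaken : ∀ {g l y y′} → y ≤ y′ → Head g l y → Head g l y′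
weaken y≤y′ h = record
  { Head h ; need = λ z t y′<z → Head.need h z t (≤-<-trans y≤y′ y′<z) }

row-++-replicate : ∀ s c z x → row s (c ++ replicate z x) ≡ row s c ++ replicate z (entry s x)
row-++-replicate s c z x = trans (map-++ (entry s) c (replicate z x))
  (cong (row s c ++_) (map-replicate (entry s) z x))

length-++-replicate : ∀ {A : Set} (c : List A) z x → length (c ++ replicate z x) ≡ length c + z
length-++-replicate c z x = trans (length-++ c) (cong (length c +_) (length-replicate z))

entry-only : ∀ s → entry s (only s) ≡ true
entry-only true = refl
entry-only false = refl

entry-only-not : ∀ s → entry s (only (not s)) ≡ false
entry-only-not true = refl
entry-only-not false = refl

row-only : ∀ s c z → row s (c ++ replicate z (only s)) ≡ row s c ++ replicate z true
row-only s c z = trans (row-++-replicate s c z (only s))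
  (cong (λ b → row s c ++ replicate z b) (entry-only s))

row-only-not : ∀ s c z → row s (c ++ replicate z (only (not s))) ≡ row s c ++ replicate z false
row-only-not s c z = trans (row-++-replicate s c z (only (not s)))
  (cong (λ b → row s c ++ replicate z b) (entry-only-not s))

-- The waiting row receives z > y zeros and becomes free, while the free row receives z ones and
-- waits in turn. The new columns are complementary, so the gain is unchanged.
extend : ∀ {g l y z} → y < z → Head g l y → Head g (l + z) z
extend {g} {l} {y} {z} y<z h = record
  { columns = columns ++ replicate z (only (not side))
  ; length-columns = trans (length-++-replicate columns z _) (cong (_+ z) length-columns)
  ; side = not side
  ; need = subst (Need z) (sym (row-only (not side) columns z)) (Free⇒Need (row (not side) columns) z free)
  ; free = subst Free
      (sym (trans (cong (λ s → row s (columns ++ replicate z (only (not side)))) (not-involutive side))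
                  (row-only-not side columns z)))
      (Need⇒Free (row side columns) y<z need)
  ; cost≡ = trans (cost-only columns (not side) z) (trans (cong (_+ z) cost≡) (+-assoc g l z))
  ; residue≡0 = trans (residue-only columns (not side) z) residue≡0
  }
  where open Head h

zeros-++ : ∀ a b w → replicate a false ++ replicate b false ++ w ≡ replicate (a + b) false ++ w
zeros-++ zero b w = refl
zeros-++ (suc a) b w = cong (false ∷_) (zeros-++ a b w)

either-side : ∀ {P : Bool → Set} s → P s → P (not s) → ∀ t → P t
either-side true p q true = p
either-side true p q false = q
either-side false p q true = q
either-side false p q false = p

-- The row that is waiting for more than 2j + 2 zeros gets (j + 1) + j + 2 of them;
-- meanwhile the other row has a last run of j + 1 ones, followed by j + 2 zeros.
finish : ∀ {g l n} j k → Head (suc g) l (j + (2 + j)) → j ≡ g + k → n ≡ l + suc j + j →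
  (4 * k + 3) * (4 * k + 3) ≤ 16 + 8 * n → Certificate n
finish {g} {l} j k h refl refl low = record
  { columns = run ++ replicate j gap
  ; length-columns = trans (length-++-replicate run j gap) (cong (_+ j)
      (trans (length-++-replicate columns (suc j) _) (cong (_+ suc j) length-columns)))
  ; valid = either-side side
      (valid side (subst RunConstrained (sym side-word) (need (suc j + (2 + j)) [] ≤-refl _)))
      (valid (not side) (subst (λ w → RunConstrained (w ++ zeros))
         (sym (row-only (not side) columns (suc j)))
         (Free⇒Need (row (not side) columns) (suc j) free (2 + j) [] ≤-refl _)))
  ; residue≡0 = trans (potential-gap false run j) (trans (residue-only columns _ _) residue≡0)
  ; k = k
  ; k-bound = low
  -- The gain g + 1 and the loss of j common 0s, with j = g + k, make the cost exactly n + 1 - k.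
  ; n∸k<cost = subst (l + suc j + j ∸ k <_) (sym cost-run)
      (m<n+o⇒m∸n<o (l + suc j + j) k (≤-reflexive (arith g l k)))
  }
  where
  open Head h
  run : List Column
  run = columns ++ replicate (suc j) (only (not side))
  zeros : List Bool
  zeros = replicate (2 + j) false ++ []
  valid : ∀ s → RunConstrained (row s run ++ zeros) →
    RunConstrained (row s (run ++ replicate j gap) ++ false ∷ false ∷ [])
  valid s = subst RunConstrained (begin
    row s run ++ zeros
      ≡⟨ cong (row s run ++_) (trans (cong (λ a → replicate a false ++ []) (+-comm 2 j))
                                     (sym (zeros-++ j 2 []))) ⟩
    row s run ++ replicate j false ++ false ∷ false ∷ []
      ≡⟨ ++-assoc (row s run) (replicate j false) _ ⟨
    (row s run ++ replicate j false) ++ false ∷ false ∷ []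
      ≡⟨ cong (_++ _) (trans (cong (λ b → row s run ++ replicate j b) (entry-gap s))
                             (sym (row-++-replicate s run j gap))) ⟩
    row s (run ++ replicate j gap) ++ false ∷ false ∷ [] ∎)
    where
    open ≡-Reasoning
    entry-gap : ∀ s → false ≡ entry s gap
    entry-gap true = refl
    entry-gap false = refl
  side-word : row side run ++ zeros ≡ row side columns ++ replicate (suc j + (2 + j)) false ++ []
  side-word = begin
    row side run ++ zeros
      ≡⟨ cong (_++ zeros) (row-only-not side columns (suc j)) ⟩
    (row side columns ++ replicate (suc j) false) ++ zeros
      ≡⟨ ++-assoc (row side columns) (replicate (suc j) false) zeros ⟩
    row side columns ++ replicate (suc j) false ++ zeros
      ≡⟨ cong (row side columns ++_) (zeros-++ (suc j) (2 + j) []) ⟩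
    row side columns ++ replicate (suc j + (2 + j)) false ++ [] ∎
    where open ≡-Reasoning
  cost-run : cost (run ++ replicate j gap) ≡ suc g + l + suc j
  cost-run = trans (potential-gap true run j)
    (trans (cost-only columns (not side) (suc j)) (cong (_+ suc j) cost≡))
  arith : ∀ g l k → suc (l + suc (g + k) + (g + k)) ≡ k + (suc g + l + suc (g + k))
  arith = solve-∀

-- m tiles hold a run of 3m ones over m blocks 100.
tiles : ℕ → List Column
tiles zero = []
tiles (suc m) = (true , true) ∷ only true ∷ only true ∷ tiles m

-- The last common 1 opens a run of the second row, which the next block prolongs. Cost minus length
-- is m - 1 for `overlapping` and `delayed`, and m for `shifted`, where the second row starts with
-- 11000.
overlapping delayed shifted : ℕ → List Column
overlapping m = tiles m ++ (true , true) ∷ []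
delayed m = only true ∷ overlapping m
shifted m = only false ∷ (true , true) ∷ only true ∷ only true ∷ only true ∷ overlapping m

Free-tiles : ∀ m → Free (row false (tiles m))
Free-tiles zero t ok = ok
Free-tiles (suc m) t ok = RC-block {1} {2} (row false (tiles m) ++ t) ≤-refl (Free-tiles m t ok)

-- Five common 1s give gain 5 - 2 = 3, hence g = 2 and j = k + 2 in `finish`.
head-tiles : Head 3 15 15
head-tiles = record
  { columns = tiles 5
  ; length-columns = refl
  ; side = true
  ; need = Free⇒Need [] 15 λ t ok → ok
  ; free = Free-tiles 5
  ; cost≡ = refl
  ; residue≡0 = refl
  }

head-overlapping : Head 3 27 15
head-overlapping = record
  -- The 13 ones of the first row require 14 zeros; with the last common 1, the second row gets a
  -- run of 15, the same bound as in `head-tiles`.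
  { columns = overlapping 4 ++ replicate 14 (only false)
  ; length-columns = refl
  ; side = false
  ; need = Free⇒Need (row false (tiles 4)) 15 (Free-tiles 4)
  ; free = Need⇒Free (replicate 13 true) ≤-refl (Free⇒Need [] 13 λ t ok → ok)
  ; cost≡ = refl
  ; residue≡0 = refl
  }

-- The length of a head of length l after appending the runs of lengths y + 1, …, y + r
-- that are selected by the vector.
weigh : ∀ {r} → Vec Bool r → ℕ → ℕ → ℕ
weigh [] l y = l
weigh (true ∷ bs) l y = weigh bs (l + suc y) (suc y)
weigh (false ∷ bs) l y = weigh bs l (suc y)

extend-all : ∀ {g l y r} (bs : Vec Bool r) → Head g l y → Head g (weigh bs l y) (r + y)
extend-all [] h = h
extend-all {g} {y = y} {suc r} (true ∷ bs) h =
  subst (Head g _) (+-suc r y) (extend-all bs (extend (n<1+n y) h))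
extend-all {g} {y = y} {suc r} (false ∷ bs) h =
  subst (Head g _) (+-suc r y) (extend-all bs (weaken (n≤1+n y) h))

-- The runs of lengths 16, …, 28 without the ones at positions a and b.
skipping : Fin 13 × Fin 13 → Vec Bool 13
skipping (a , b) = Vec.tabulate λ i → not (does (i Fin.≟ a)) ∧ not (does (i Fin.≟ b))

Reaches : ℕ → ℕ → Set
Reaches start l = ∃[ a ] ∃[ b ] weigh (skipping (a , b)) start 15 ≡ l

reaches? : ∀ start l → Dec (Reaches start l)
reaches? start l = any? λ a → any? λ b → weigh (skipping (a , b)) start 15 ≟ l

∈-interval : ∀ {a n b} → a ≤ n → n ≤ b → n ∈ interval a b
∈-interval {a} {n} {b} a≤n n≤b = subst (_∈ interval a b) (m+[n∸m]≡n a≤n)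
  (∈-map⁺ (a +_) (∈-upTo⁺ (s≤s (∸-monoˡ-≤ a n≤b))))

-- The runs 16 to 28 sum to 286. Omitting two of them gives the lengths 246 to 268 from 15 and 258
-- to 280 from 27; omitting one, the case a = b, gives 273 to 285 and 285 to 297.
reaches : All (λ l → Reaches 15 l ⊎ Reaches 27 l) (interval 248 296)
reaches = from-yes (All.all? (λ l → reaches? 15 l ⊎-dec reaches? 27 l) (interval 248 296))

reached-head : ∀ {start l} → Head 3 start 15 → Reaches start l → Head 3 l 28
reached-head h (a , b , eq) = subst (λ l → Head 3 l 28) eq (extend-all (skipping (a , b)) h)

-- The case k = 11, j = 13: n runs from 275 to 323, the ending takes 14 + 13 columns, and 28 = 2j +
-- 2.
head₀ : ∀ {l} → 248 ≤ l → l ≤ 296 → Head 3 l 28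
head₀ lo hi =
  [ reached-head head-tiles , reached-head head-overlapping ]′ (All.lookup reaches (∈-interval lo hi))

-- With k = 11 + i and j = 13 + i, the floor term is k for the n from 2k² + 3k = bottom i
-- to 2k² + 7k + 4 = top i + (2j + 1).
bottom top : ℕ → ℕ
bottom i = 2 * i * i + 47 * i + 275
top i = 2 * i * i + 49 * i + 296

-- Here 277 + 2i is 248 plus the first new run 29 + 2i: a length above `top i` remains at least 248
-- once that run is removed.
277+i+i≤top : ∀ i → 277 + (i + i) ≤ top i
277+i+i≤top i = ≤-trans (m≤m+n _ (2 * i * i + 47 * i + 19)) (≤-reflexive (eq i))
  where
  eq : ∀ i → 277 + (i + i) + (2 * i * i + 47 * i + 19) ≡ 2 * i * i + 49 * i + 296
  eq = solve-∀

-- The upper end grows by 51 + 4i, while the two new runs total 59 + 4i.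
top-suc : ∀ i → top (suc i) ≤ top i + (59 + (i + i + (i + i)))
top-suc i = ≤-trans (m≤m+n _ 8) (≤-reflexive (eq i))
  where
  eq : ∀ i → 2 * suc i * suc i + 49 * suc i + 296 + 8
           ≡ 2 * i * i + 49 * i + 296 + (59 + (i + i + (i + i)))
  eq = solve-∀

-- From i to suc i, runs of lengths 29 + 2i and 30 + 2i become available: the new
-- interval is covered by its predecessor, shifted by 0, by the first or by both.
heads : ∀ i {l} → 248 ≤ l → l ≤ top i → Head 3 l (28 + (i + i))
heads zero lo hi = head₀ lo hi
heads (suc i) {l} lo hi = subst (Head 3 l) bound (go (l ≤? top i) (l ≤? top i + (29 + (i + i))))
  where
  bound : 30 + (i + i) ≡ 28 + (suc i + suc i)
  bound = cong (29 +_) (sym (+-suc i i))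
  step₁ : ∀ {l} → Head 3 l (28 + (i + i)) → Head 3 (l + (29 + (i + i))) (29 + (i + i))
  step₁ = extend ≤-refl
  go : Dec (l ≤ top i) → Dec (l ≤ top i + (29 + (i + i))) → Head 3 l (30 + (i + i))
  go (yes l≤) _ = weaken (m≤n+m _ 2) (heads i lo l≤)
  go (no l≰) (yes l≤) = subst (λ l → Head 3 l (30 + (i + i))) (m∸n+n≡m a≤l)
    (weaken (n≤1+n _) (step₁ (heads i (m+n≤o⇒m≤o∸n 248 lo′)
      (m≤n+o⇒m∸n≤o l _ (≤-trans l≤ (≤-reflexive (+-comm (top i) _)))))))
    where
    lo′ : 248 + (29 + (i + i)) ≤ l
    lo′ = ≤-trans (277+i+i≤top i) (<⇒≤ (≰⇒> l≰))
    a≤l : 29 + (i + i) ≤ l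
    a≤l = ≤-trans (m≤n+m _ 248) lo′
  go (no _) (no l≰) = subst (λ l → Head 3 l (30 + (i + i)))
    (trans (+-assoc (l ∸ b) _ _) (trans (cong (l ∸ b +_) (arith₁ i)) (m∸n+n≡m b≤l)))
    (extend ≤-refl (step₁ (heads i (m+n≤o⇒m≤o∸n 248 lo′)
      (m≤n+o⇒m∸n≤o l b (≤-trans hi (≤-trans (top-suc i) (≤-reflexive (+-comm (top i) _))))))))
    where
    b : ℕ
    b = 59 + (i + i + (i + i))
    arith₁ : ∀ i → 29 + (i + i) + (30 + (i + i)) ≡ 59 + (i + i + (i + i))
    arith₁ = solve-∀
    arith₂ : ∀ i → 248 + (59 + (i + i + (i + i))) ≡ suc (277 + (i + i) + (29 + (i + i)))
    arith₂ = solve-∀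
    lo′ : 248 + b ≤ l
    lo′ = ≤-trans (≤-reflexive (arith₂ i))
      (≤-trans (s≤s (+-monoˡ-≤ (29 + (i + i)) (277+i+i≤top i))) (≰⇒> l≰))
    b≤l : b ≤ l
    b≤l = ≤-trans (m≤n+m _ 248) lo′

-- Consecutive intervals abut: `bottom (suc i)` is one more than `top i + (27 + (i + i))`.
bracket : ∀ d → ∃[ i ] (bottom i ≤ 275 + d × 275 + d ≤ top i + (27 + (i + i)))
bracket zero = 0 , ≤-refl , m≤m+n 275 48
bracket (suc d) with bracket d
... | i , lo , hi with 275 + suc d ≤? top i + (27 + (i + i))
...   | yes hi′ = i , ≤-trans lo (+-monoʳ-≤ 275 (n≤1+n d)) , hi′
...   | no ¬hi′ = suc i , ≤-trans (≤-reflexive (eq i)) (≰⇒> ¬hi′) ,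
  ≤-trans (≤-reflexive (+-suc 275 d))
    (≤-trans (s≤s hi) (≤-trans (m≤m+n _ (52 + 4 * i)) (≤-reflexive (eq′ i))))
  where
  eq : ∀ i → 2 * suc i * suc i + 47 * suc i + 275 ≡ suc (2 * i * i + 49 * i + 296 + (27 + (i + i)))
  eq = solve-∀
  eq′ : ∀ i → suc (2 * i * i + 49 * i + 296 + (27 + (i + i))) + (52 + 4 * i)
            ≡ 2 * suc i * suc i + 49 * suc i + 296 + (27 + (suc i + suc i))
  eq′ = solve-∀

large : ∀ d → Certificate (275 + d)
large d with bracket d
... | i , lo , hi =
  finish (13 + i) (11 + i) (subst (Head 3 l) (nb i) (heads i (m+n≤o⇒m≤o∸n 248 lo′) l≤top)) refl
    (trans (sym (m∸n+n≡m (≤-trans (m≤n+m e 248) lo′)))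
           (trans (cong (l +_) (eq i)) (sym (+-assoc l (14 + i) (13 + i)))))
    -- At n = 2k² + 3k, the number 16 + 8n exceeds (4k + 3)² by 7.
    (≤-trans (m≤m+n _ 7) (≤-trans (≤-reflexive (sq i)) (+-monoʳ-≤ 16 (*-monoʳ-≤ 8 lo))))
  where
  e l : ℕ
  -- The last run, of length j + 1, together with the j common 0s.
  e = 27 + (i + i)
  l = 275 + d ∸ e
  lo′ : 248 + e ≤ 275 + d
  lo′ = ≤-trans (≤-trans (m≤m+n _ (2 * i * i + 45 * i)) (≤-reflexive (eq₀ i))) lo
    where
    eq₀ : ∀ i → 248 + (27 + (i + i)) + (2 * i * i + 45 * i) ≡ 2 * i * i + 47 * i + 275
    eq₀ = solve-∀
  l≤top : l ≤ top i
  l≤top = m≤n+o⇒m∸n≤o (275 + d) e (≤-trans hi (≤-reflexive (+-comm (top i) e)))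
  nb : ∀ i → 28 + (i + i) ≡ 13 + i + (2 + (13 + i))
  nb = solve-∀
  eq : ∀ i → 27 + (i + i) ≡ 14 + i + (13 + i)
  eq = solve-∀
  sq : ∀ i → (4 * (11 + i) + 3) * (4 * (11 + i) + 3) + 7 ≡ 16 + 8 * (2 * i * i + 47 * i + 275)
  sq = solve-∀

-- Pairs of words of small length

alternate : Bool → List ℕ → List Column
alternate s [] = []
alternate s (z ∷ zs) = replicate z (only s) ++ alternate (not s) zs

-- The j common 0s and the last run, of length j + 1, are as in `finish`; the other data
-- were found by a computer search.
pairing : List Column → List ℕ → ℕ → List Column
pairing p zs j = p ++ alternate false (zs ++ suc j ∷ []) ++ replicate j gap

-- A decidable form of `Certificate`, checked by evaluation; its k is the smallest that can satisfy
-- `n ∸ k < cost c`.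
Certifies : ℕ → List Column → Set
Certifies n c = length c ≡ n
  × RunConstrained (row true c ++ false ∷ false ∷ [])
  × RunConstrained (row false c ++ false ∷ false ∷ [])
  × residue c ≡ 0
  × (let k = suc n ∸ cost c in (4 * k + 3) * (4 * k + 3) ≤ 16 + 8 * n × n ∸ k < cost c)

certifies? : ∀ n c → Dec (Certifies n c)
certifies? n c = length c ≟ n
  ×-dec RC? (row true c ++ false ∷ false ∷ [])
  ×-dec RC? (row false c ++ false ∷ false ∷ [])
  ×-dec residue c ≟ 0
  ×-dec (let k = suc n ∸ cost c in
         (4 * k + 3) * (4 * k + 3) ≤? 16 + 8 * n ×-dec n ∸ k <? cost c)

certificate : ∀ n c → Certifies n c → Certificate n
certificate n c (len , ok₁ , ok₂ , res , low , gain) = record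
  { columns = c ; length-columns = len ; valid = either-side true ok₁ ok₂
  ; residue≡0 = res ; k = suc n ∸ cost c ; k-bound = low ; n∸k<cost = gain }

lookup-certificate : ∀ {ns cs n} → Pointwise Certifies ns cs → n ∈ ns → Certificate n
lookup-certificate {n ∷ _} {c ∷ _} (p ∷ ps) (here refl) = certificate n c p
lookup-certificate (p ∷ ps) (there n∈) = lookup-certificate ps n∈

-- The order is that of `S₂`, as the pointwise check requires.
pairs-S₂ : List (List Column)
pairs-S₂ =
  pairing (overlapping 5) (17 ∷ 19 ∷ 20 ∷ []) 9 ∷
  pairing (overlapping 3) (11 ∷ interval 13 16) 7 ∷
  pairing (overlapping 4) (14 ∷ interval 16 18) 8 ∷
  pairing (overlapping 3) (12 ∷ interval 14 18) 8 ∷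
  pairing (overlapping 4) (14 ∷ interval 17 20) 9 ∷
  pairing (tiles 6) (interval 19 22) 10 ∷
  pairing (tiles 4) (interval 13 18) 8 ∷
  pairing (shifted 3) (15 ∷ interval 17 20) 9 ∷
  pairing (tiles 5) (interval 16 20) 9 ∷
  pairing (overlapping 3) (11 ∷ interval 13 18) 8 ∷
  pairing (overlapping 4) (14 ∷ interval 16 20) 9 ∷
  pairing (tiles 3) (interval 10 18) 8 ∷
  pairing (tiles 5) (interval 17 22) 10 ∷
  pairing (overlapping 7) (24 ∷ interval 26 28) 13 ∷
  pairing (overlapping 3) (11 ∷ interval 13 16 ++ interval 18 20) 9 ∷
  pairing (overlapping 3) (11 ∷ interval 13 15 ++ interval 17 20) 9 ∷
  pairing (tiles 8) (interval 25 28) 13 ∷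
  pairing (overlapping 2) (8 ∷ interval 10 18) 8 ∷
  pairing (overlapping 3) (11 ∷ interval 14 20) 9 ∷
  pairing (overlapping 3) (12 ∷ interval 14 20) 9 ∷
  pairing (overlapping 5) (17 ∷ interval 19 23) 11 ∷
  pairing (overlapping 6) (20 ∷ interval 23 26) 12 ∷
  pairing (tiles 4) (interval 13 20) 9 ∷
  pairing (overlapping 4) (14 ∷ 16 ∷ interval 18 22) 10 ∷
  pairing (overlapping 4) (14 ∷ interval 17 22) 10 ∷
  pairing (tiles 7) (interval 22 26) 12 ∷
  pairing (overlapping 5) (18 ∷ interval 20 24) 11 ∷
  pairing (delayed 5) (18 ∷ interval 20 24) 11 ∷
  pairing (tiles 5) (interval 16 22) 10 ∷
  pairing (tiles 6) (interval 19 24) 11 ∷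
  pairing (overlapping 3) (11 ∷ interval 13 20) 9 ∷
  pairing (overlapping 7) (23 ∷ interval 25 28) 13 ∷
  pairing (overlapping 4) (14 ∷ interval 16 22) 10 ∷
  pairing (overlapping 6) (20 ∷ interval 22 26) 12 ∷
  pairing (overlapping 5) (17 ∷ interval 19 24) 11 ∷
  pairing (tiles 4) (interval 13 18 ++ interval 20 22) 10 ∷
  pairing (tiles 4) (interval 13 17 ++ interval 19 22) 10 ∷
  pairing (tiles 4) (interval 13 16 ++ interval 18 22) 10 ∷
  pairing (tiles 4) (interval 13 15 ++ interval 17 22) 10 ∷
  pairing (tiles 3) (interval 10 20) 9 ∷
  pairing (tiles 5) (interval 16 23) 11 ∷
  pairing (tiles 4) (interval 14 22) 10 ∷
  pairing (tiles 5) (interval 16 21 ++ 23 ∷ 24 ∷ []) 11 ∷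
  pairing (tiles 6) (interval 19 25) 12 ∷
  pairing (tiles 5) (interval 16 19 ++ interval 21 24) 11 ∷
  pairing (tiles 5) (interval 16 18 ++ interval 20 24) 11 ∷
  pairing (tiles 5) (16 ∷ 17 ∷ interval 19 24) 11 ∷
  pairing (tiles 7) (interval 23 28) 13 ∷
  pairing (tiles 5) (interval 17 24) 11 ∷
  pairing (tiles 6) (19 ∷ interval 21 26) 12 ∷
  pairing (tiles 6) (interval 20 26) 12 ∷
  pairing (overlapping 3) (12 ∷ interval 14 22) 10 ∷
  pairing (overlapping 4) (14 ∷ interval 16 23) 11 ∷
  pairing (overlapping 4) (14 ∷ interval 16 22 ++ 24 ∷ []) 11 ∷
  pairing (tiles 4) (interval 13 22) 10 ∷
  pairing (overlapping 7) (23 ∷ interval 25 29) 14 ∷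
  pairing (overlapping 4) (14 ∷ interval 16 19 ++ interval 21 24) 11 ∷
  pairing (overlapping 4) (14 ∷ interval 16 18 ++ interval 20 24) 11 ∷
  pairing (overlapping 5) (17 ∷ interval 19 25) 12 ∷
  pairing (overlapping 6) (20 ∷ interval 22 27) 13 ∷
  pairing (overlapping 4) (14 ∷ interval 17 24) 11 ∷
  pairing (overlapping 4) (15 ∷ interval 17 24) 11 ∷
  pairing (overlapping 5) (17 ∷ interval 19 21 ++ interval 23 26) 12 ∷
  pairing (overlapping 3) (11 ∷ interval 13 22) 10 ∷
  pairing (tiles 5) (interval 16 24) 11 ∷
  pairing (overlapping 5) (17 ∷ interval 20 26) 12 ∷
  pairing (overlapping 5) (18 ∷ interval 20 26) 12 ∷
  pairing (delayed 5) (18 ∷ interval 20 26) 12 ∷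
  pairing (shifted 4) (18 ∷ interval 20 26) 12 ∷
  pairing (tiles 6) (interval 19 26) 12 ∷
  []

-- These lengths precede 275 = 2 · 11² + 3 · 11, where the general construction begins.
pairs-230-274 : List (List Column)
pairs-230-274 =
  pairing (tiles 4) (interval 15 24) 11 ∷
  pairing (tiles 5) (interval 17 23 ++ 25 ∷ 26 ∷ []) 12 ∷
  pairing (tiles 7) (interval 23 29) 14 ∷
  pairing (tiles 4) (interval 13 23) 11 ∷
  pairing (tiles 4) (interval 13 22 ++ 24 ∷ []) 11 ∷
  pairing (tiles 4) (interval 13 21 ++ 23 ∷ 24 ∷ []) 11 ∷
  pairing (tiles 4) (interval 13 20 ++ interval 22 24) 11 ∷
  pairing (tiles 4) (interval 13 19 ++ interval 21 24) 11 ∷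
  pairing (tiles 3) (interval 10 22) 10 ∷
  pairing (tiles 7) (interval 24 30) 14 ∷
  pairing (tiles 4) (interval 13 16 ++ interval 18 24) 11 ∷
  pairing (tiles 6) (interval 21 28) 13 ∷
  pairing (tiles 4) (13 ∷ 14 ∷ interval 16 24) 11 ∷
  pairing (tiles 9) (interval 28 33) 16 ∷
  pairing (tiles 4) (interval 14 24) 11 ∷
  pairing (tiles 5) (interval 16 25) 12 ∷
  pairing (tiles 5) (interval 16 24 ++ 26 ∷ []) 12 ∷
  pairing (tiles 5) (interval 16 23 ++ 25 ∷ 26 ∷ []) 12 ∷
  pairing (tiles 5) (interval 16 22 ++ interval 24 26) 12 ∷
  pairing (tiles 9) (interval 29 34) 16 ∷
  pairing (tiles 5) (interval 16 20 ++ interval 22 26) 12 ∷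
  pairing (tiles 8) (interval 25 31) 15 ∷
  pairing (tiles 6) (interval 19 27) 13 ∷
  pairing (tiles 5) (16 ∷ 17 ∷ interval 19 26) 12 ∷
  pairing (tiles 7) (interval 22 29) 14 ∷
  pairing (tiles 5) (interval 17 26) 12 ∷
  pairing (tiles 6) (interval 19 23 ++ interval 25 28) 13 ∷
  pairing (tiles 4) (interval 13 24) 11 ∷
  pairing (tiles 8) (interval 26 32) 15 ∷
  pairing (tiles 6) (19 ∷ 20 ∷ interval 22 28) 13 ∷
  pairing (tiles 6) (19 ∷ interval 21 28) 13 ∷
  pairing (tiles 6) (interval 20 28) 13 ∷
  pairing (tiles 7) (interval 23 30) 14 ∷
  pairing (overlapping 4) (14 ∷ interval 16 19 ++ interval 21 26) 12 ∷
  pairing (overlapping 4) (14 ∷ interval 16 18 ++ interval 20 26) 12 ∷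
  pairing (overlapping 4) (14 ∷ 16 ∷ 17 ∷ interval 19 26) 12 ∷
  pairing (overlapping 3) (11 ∷ interval 13 24) 11 ∷
  pairing (overlapping 4) (14 ∷ interval 17 26) 12 ∷
  pairing (overlapping 4) (15 ∷ interval 17 26) 12 ∷
  pairing (overlapping 5) (17 ∷ interval 19 25 ++ 27 ∷ 28 ∷ []) 13 ∷
  pairing (overlapping 5) (17 ∷ interval 19 24 ++ interval 26 28) 13 ∷
  pairing (tiles 5) (interval 16 26) 12 ∷
  pairing (overlapping 6) (20 ∷ interval 22 29) 14 ∷
  pairing (overlapping 8) (26 ∷ interval 29 34) 16 ∷
  pairing (overlapping 8) (27 ∷ interval 29 34) 16 ∷
  []

certified-S₂ : Pointwise Certifies S₂ pairs-S₂
certified-S₂ = from-yes (Pointwise.decidable certifies? S₂ pairs-S₂)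

certified-230-274 : Pointwise Certifies (interval 230 274) pairs-230-274
certified-230-274 = from-yes (Pointwise.decidable certifies? (interval 230 274) pairs-230-274)

certificates : ∀ n → InS n → Certificate n
certificates n (inj₂ n∈S₂) = lookup-certificate certified-S₂ n∈S₂
certificates n (inj₁ 230≤n) with n ≤? 274
... | yes n≤274 = lookup-certificate certified-230-274 (∈-interval 230≤n n≤274)
... | no n≰274 = subst Certificate (m+[n∸m]≡n (≰⇒> n≰274)) (large (n ∸ 275))

theorem4p3 : (n : ℕ) → InS n →
    ∃[ D ] (IsDiam n D × (∀ k → IsFloorTerm n k → n ∸ k < D))
theorem4p3 n n∈S = theorem-from-certificate (certificates n n∈S)
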